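{- Let $\lambda$ be an infinite cardinal such that $\lambda = \lambda^{<\lambda}$. Then there exists an epi-universal group in the class $\mathcal{LN}_\lambda$; that is, there is a locally nilpotent group $G$ with $|G|\le \lambda$ such that every locally nilpotent group $H$ with $|H|\le\lambda$ is an epimorphic image of $G$.
   Context: A group $G$ is locally nilpotent if every finitely generated subgroup of $G$ is nilpotent. $\mathcal{LN}_\lambda$ denotes the class of all locally nilpotent groups of cardinality at most $\lambda$. A group $G\in\mathcal{LN}_\lambda$ is called epi-universal in $\mathcal{LN}_\lambda$ if for every $H\in\mathcal{LN}_\lambda$ there is a surjective group homomorphism $G\to H$. As usual $\lambda^{<\lambda}=\sup\{\lambda^{\mu}\mid \mu<\lambda \text{ a cardinal}\}$. -}

module Defs where

open import Algebra.Bundles using (Group)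
open import Algebra.Morphism.Structures using (module GroupMorphisms)
open import Data.List.Base using (List)
import Data.List.Membership.Setoid as Membership
open import Data.Nat.Base using (ℕ; zero; suc)
open import Data.Product.Base using (Σ; ∃; ∃₂; _×_; _,_; proj₁)
open import Data.Unit.Polymorphic.Base using (⊤)
open import Function.Base using (_on_)
open import Function.Bundles using (Injection)
open import Function.Definitions using (Injective; Surjective)
open import Induction.WellFounded using (WellFounded)
open import Level using (Level; _⊔_)
open import Relation.Binary.Bundles using (Setoid)
open import Relation.Binary.Core using (Rel)
open import Relation.Binary.Structures using (IsStrictTotalOrder)
open import Relation.Binary.PropositionalEquality using (_≡_; setoid; _→-setoid_)
open import Relation.Nullary.Negation using (¬_)
open import Relation.Unary using (Pred)

private
  variable
    c ℓ p : Level

-- Cardinals are initial ordinals: well-orders that do not inject into any of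
-- their proper initial segments { β ∣ β < α }.  Finite cardinals are included.
-- The segment is expressed by a bound on f rather than as the type
-- Σ β (β < α), because β < α need not be proof-irrelevant.
record Cardinal ℓ : Set (Level.suc ℓ) where
  infix 4 _<_
  field
    Carrier            : Set ℓ
    _<_                : Rel Carrier ℓ
    isStrictTotalOrder : IsStrictTotalOrder _≡_ _<_
    wellFounded        : WellFounded _<_
    initial            : ∀ α (f : Carrier → Carrier) → Injective _≡_ _≡_ f →
                         ¬ (∀ β → f β < α)

open Cardinal using () renaming (Carrier to ⌊_⌋)

infix 4 _≲_ _≺_

-- The cardinality of the set A (a setoid) is at most κ.
_≲_ : ∀ {c ℓ k} → Setoid c ℓ → Cardinal k → Set (c ⊔ ℓ ⊔ k)
A ≲ κ = Injection A (setoid ⌊ κ ⌋)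

_≺_ : Rel (Cardinal ℓ) ℓ
μ ≺ κ = (setoid ⌊ μ ⌋ ≲ κ) × ¬ (setoid ⌊ κ ⌋ ≲ μ)

Infinite : Cardinal ℓ → Set ℓ
Infinite κ = setoid ℕ ≲ κ

-- κ = sup { |A i| ∣ i ∈ I } in the order of cardinals.
IsSupremum : ∀ {i ℓ} {I : Set i} → Cardinal ℓ → (I → Setoid ℓ ℓ) → Set (i ⊔ Level.suc ℓ)
IsSupremum {ℓ = ℓ} κ A =
  (∀ i → A i ≲ κ) ×
  (∀ (ν : Cardinal ℓ) → (∀ i → A i ≲ ν) → setoid ⌊ κ ⌋ ≲ ν)

-- κ = κ^{<κ}, where κ^μ is the set of functions μ → κ up to pointwise equality.
IsOwnWeakPower : Cardinal ℓ → Set (Level.suc ℓ)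
IsOwnWeakPower {ℓ} κ =
  IsSupremum {I = Σ (Cardinal ℓ) (_≺ κ)} κ (λ (μ , _) → ⌊ μ ⌋ →-setoid ⌊ κ ⌋)

module _ (G : Group c ℓ) where
  open Group G

  -- The subgroup of G generated by the elements satisfying P.
  data Generated (P : Pred Carrier p) : Pred Carrier (c ⊔ ℓ ⊔ p) where
    gen  : ∀ {x} → P x → Generated P x
    unit : Generated P ε
    mul  : ∀ {x y} → Generated P x → Generated P y → Generated P (x ∙ y)
    inv  : ∀ {x} → Generated P x → Generated P (x ⁻¹)
    resp : ∀ {x y} → x ≈ y → Generated P x → Generated P y

  generatedGroup : Pred Carrier p → Group (c ⊔ ℓ ⊔ p) ℓ
  generatedGroup P = record
    { Carrier = ∃ (Generated P)
    ; _≈_     = _≈_ on proj₁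
    ; _∙_     = λ (x , x∈) (y , y∈) → x ∙ y , mul x∈ y∈
    ; ε       = ε , unit
    ; _⁻¹     = λ (x , x∈) → x ⁻¹ , inv x∈
    ; isGroup = record
      { isMonoid = record
        { isSemigroup = record
          { isMagma = record
            { isEquivalence = record { refl = refl ; sym = sym ; trans = trans }
            ; ∙-cong        = ∙-cong
            }
          ; assoc = λ (x , _) (y , _) (z , _) → assoc x y z
          }
        ; identity = (λ (x , _) → identityˡ x) , (λ (x , _) → identityʳ x)
        }
      ; inverse = (λ (x , _) → inverseˡ x) , (λ (x , _) → inverseʳ x)
      ; ⁻¹-cong = ⁻¹-cong
      }
    }

  ⟨_⟩ : List Carrier → Group (c ⊔ ℓ) ℓ
  ⟨ xs ⟩ = generatedGroup (λ x → x ∈ xs)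
    where open Membership (Group.setoid G) using (_∈_)

  [_,_] : Carrier → Carrier → Carrier
  [ x , y ] = x ⁻¹ ∙ y ⁻¹ ∙ x ∙ y

  -- lowerCentral n is the term γₙ₊₁ of the lower central series γ₁ = G, γₙ₊₁ = [γₙ , G].
  lowerCentral : ℕ → Pred Carrier (c ⊔ ℓ)
  lowerCentral zero    = λ _ → ⊤
  lowerCentral (suc n) = Generated (λ z → ∃₂ λ x y → lowerCentral n x × z ≈ [ x , y ])

  Nilpotent : Set (c ⊔ ℓ)
  Nilpotent = ∃ λ n → ∀ x → lowerCentral n x → x ≈ ε

LocallyNilpotent : Group c ℓ → Set (c ⊔ ℓ)
LocallyNilpotent G = ∀ (xs : List (Group.Carrier G)) → Nilpotent (⟨_⟩ G xs)

-- The class 𝓛𝓝_κ.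
record LN (κ : Cardinal ℓ) (G : Group ℓ ℓ) : Set ℓ where
  field
    locallyNilpotent : LocallyNilpotent G
    cardinality      : Group.setoid G ≲ κ

_↠ᴳ_ : Group ℓ ℓ → Group ℓ ℓ → Set ℓ
G ↠ᴳ H = ∃ λ (f : G.Carrier → H.Carrier) →
  IsGroupHomomorphism f × Surjective G._≈_ H._≈_ f
  where
  module G = Group G
  module H = Group H
  open GroupMorphisms G.rawGroup H.rawGroup using (IsGroupHomomorphism)

record EpiUniversal (κ : Cardinal ℓ) (G : Group ℓ ℓ) : Set (Level.suc ℓ) where
  field
    member    : LN κ G
    universal : ∀ (H : Group ℓ ℓ) → LN κ H → G ↠ᴳ H

-- Enumerate a locally nilpotent group H as h δ for δ < κ, and let F D be the nilpotency
-- class of the subgroup generated by h δ for δ in the finite set D.  Such functions F form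
-- a tree: a node at level δ records δ and the values of F on the finite sets with maximum
-- δ, and κ^{<κ} = κ leaves only κ nodes.  Let G be generated by all nodes, subject to: a
-- finite set S of nodes generates a nilpotent subgroup whose class is at most any n that
-- bounds F D for all F and all nonempty D such that the nodes of F at the levels in D
-- belong to S.  A node fixes the values of F on the sets with its level as maximum, so
-- such an n exists and G is locally nilpotent.  Sending the node of F at level δ to h δ,
-- and the nodes off the branch of F to 1, respects the relations and maps G onto H.
module Submission where

open import Defs
open import Algebra.Bundles using (Group)
open import Axiom.ExcludedMiddle using (ExcludedMiddle)
open import Data.Product.Base using (∃)

open import Algebra.Morphism.Structures using (module GroupMorphisms)
import Algebra.Properties.Group as GroupProperties
open import Data.Bool.Properties using (T-irrelevant)
open import Data.List.Base using (List; []; _∷_; _++_; map; concatMap)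
import Data.List.Membership.Setoid as Membership
open import Data.List.Membership.Propositional using (_∈_)
open import Data.List.Membership.Propositional.Properties using (∈-map⁺; ∈-++⁺ˡ; ∈-++⁺ʳ)
open import Data.List.Relation.Unary.All using (All; []; _∷_; tabulate)
import Data.List.Relation.Unary.All as All
open import Data.List.Relation.Unary.AllPairs using (AllPairs; []; _∷_)
open import Data.List.Relation.Unary.Any using (here; there)
import Data.List.Relation.Unary.Any as Any
open import Data.Nat.Base using (ℕ; zero; suc; _≤_; _⊔_; _≤′_; ≤′-reflexive; ≤′-step)
open import Data.Nat.Properties using (≤-reflexive; ≤-trans; m≤m⊔n; m≤n⊔m; ≤⇒≤′)
open import Data.Product.Base using (_×_; _,_; proj₁; proj₂; ∃₂)
open import Data.Unit.Polymorphic.Base using (tt)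
open import Function.Base using (_∘_; flip; _on_)
open import Function.Bundles using (Injection)
open import Function.Definitions using (Injective)
open import Induction.WellFounded using (Acc; acc)
open import Relation.Binary.Definitions using (Trichotomous; tri<; tri≈; tri>)
import Relation.Binary.Construct.On as On
open import Relation.Binary.PropositionalEquality
  using (_≡_; _≢_; refl; sym; trans; cong; cong₂; subst; isEquivalence; resp₂; module ≡-Reasoning)
open import Relation.Binary.Structures using (IsStrictTotalOrder)
open import Relation.Nullary using (Dec; yes; no; ¬_; contradiction)
open import Relation.Nullary.Decidable using (True; toWitness; fromWitness)
open import Relation.Unary using (Pred; _⊆_)

-- Least elements and the cardinals of initial segments.

module WellOrder {ℓ} (em : ExcludedMiddle ℓ) (κ : Cardinal ℓ) where

  open Cardinal κ public renaming (Carrier to K)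
  open IsStrictTotalOrder isStrictTotalOrder public
    using (_<?_; _≟_; compare; irrefl) renaming (trans to <-trans)

  IsLeast : Pred K ℓ → Pred K ℓ
  IsLeast P α = P α × (∀ {β} → P β → ¬ (β < α))

  least : ∀ {P : Pred K ℓ} → ∃ P → ∃ (IsLeast P)
  least {P} (α , Pα) = go (wellFounded α) Pα
    where
    go : ∀ {α} → Acc _<_ α → P α → ∃ (IsLeast P)
    go {α} (acc rs) Pα with em {∃ λ β → P β × β < α}
    ... | yes (β , Pβ , β<α) = go (rs β<α) Pβ
    ... | no ∄β              = α , Pα , λ {β} Pβ β<α → ∄β (β , Pβ , β<α)

  least-unique : ∀ {P Q : Pred K ℓ} {α β} → P ⊆ Q → Q ⊆ P →
                 IsLeast P α → IsLeast Q β → α ≡ β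
  least-unique {α = α} {β} P⊆Q Q⊆P (Pα , α-min) (Qβ , β-min) with compare α β
  ... | tri< α<β _ _ = contradiction α<β (β-min (P⊆Q Pα))
  ... | tri≈ _ α≡β _ = α≡β
  ... | tri> _ _ β<α = contradiction β<α (α-min (Q⊆P Qβ))

  -- An injection of the segment below α into the segment below γ, given as a total map constrained
  -- only below α, so that it cannot depend on the proof of `β < α`.
  record EmbedsBelow (α γ : K) : Set ℓ where
    field
      to        : K → K
      bounded   : ∀ {β} → β < α → to β < γ
      injective : ∀ {β β′} → β < α → β′ < α → to β ≡ to β′ → β ≡ β′

  embedsBelow-refl : ∀ α → EmbedsBelow α α
  embedsBelow-refl α = record
    { to        = λ β → β
    ; bounded   = λ β<α → β<α
    ; injective = λ _ _ eq → eq
    }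

  -- The cardinal |{ β ∣ β < α }|, realised as { β ∣ β < size } for the least size whose
  -- segment receives an injection.
  module Segment (α : K) where

    private
      least-embedding : ∃ (IsLeast (EmbedsBelow α))
      least-embedding = least (α , embedsBelow-refl α)

    size : K
    size = proj₁ least-embedding

    embedding : EmbedsBelow α size
    embedding = proj₁ (proj₂ least-embedding)

    module E = EmbedsBelow embedding

    -- `True (β <? size)` is proof-irrelevant, whereas `β < size` need not be; this makes the first
    -- projection injective.
    Below : Set ℓ
    Below = ∃ λ β → True (β <? size)

    below-≡ : ∀ {x y : Below} → proj₁ x ≡ proj₁ y → x ≡ y
    below-≡ {β , p} {.β , q} refl = cong (β ,_) (T-irrelevant p q)

    below< : (x : Below) → proj₁ x < size
    below< (β , p) = toWitness p

    -- The decision is an argument so that `restrict-≡` can match on it. The value outside the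
    -- segment is arbitrary.
    restrict′ : (Below → Below) → ∀ β → Dec (β < size) → K
    restrict′ f β (yes β<size) = proj₁ (f (β , fromWitness β<size))
    restrict′ f β (no  _)      = β

    restrict : (Below → Below) → K → K
    restrict f β = restrict′ f β (β <? size)

    restrict-≡ : ∀ f x → restrict f (proj₁ x) ≡ proj₁ (f x)
    restrict-≡ f (β , p) = go (β <? size)
      where
      go : ∀ d → restrict′ f β d ≡ proj₁ (f (β , p))
      go (yes β<size) = cong (proj₁ ∘ f) (below-≡ refl)
      go (no  β≮size) = contradiction (toWitness p) β≮size

    below-compare : Trichotomous _≡_ (_<_ on proj₁ {B = λ β → True (β <? size)})
    below-compare x y with compare (proj₁ x) (proj₁ y)
    ... | tri< a ¬b ¬c = tri< a (¬b ∘ cong proj₁) ¬c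
    ... | tri≈ ¬a b ¬c = tri≈ ¬a (below-≡ b) ¬c
    ... | tri> ¬a ¬b c = tri> ¬a (¬b ∘ cong proj₁) c

    cardinal : Cardinal ℓ
    cardinal = record
      { Carrier = Below
      ; _<_     = _<_ on proj₁
      ; isStrictTotalOrder = record
        { isStrictPartialOrder = record
          { isEquivalence = isEquivalence
          ; irrefl        = λ { refl → irrefl refl }
          ; trans         = <-trans
          ; <-resp-≈      = resp₂ _
          }
        ; compare = below-compare
        }
      ; wellFounded = On.wellFounded proj₁ wellFounded
      -- Following the embedding of the segment below α by f would embed it below γ, against the
      -- minimality of `size`.
      ; initial     = λ γ f f-inj f<γ →
          proj₂ (proj₂ least-embedding) (shrink γ f f-inj f<γ) (below< γ)
      }
      where
      shrink : ∀ γ (f : Below → Below) → Injective _≡_ _≡_ f →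
               (∀ x → proj₁ (f x) < proj₁ γ) → EmbedsBelow α (proj₁ γ)
      shrink γ f f-inj f<γ = record
        { to        = λ β → restrict f (E.to β)
        ; bounded   = λ β<α → subst (_< proj₁ γ) (sym (restrict-≡ f (image β<α))) (f<γ _)
        ; injective = λ β<α β′<α eq → E.injective β<α β′<α (cong proj₁ (f-inj
            {image β<α} {image β′<α} (below-≡
            (trans (sym (restrict-≡ f (image β<α))) (trans eq (restrict-≡ f (image β′<α)))))))
        }
        where
        image : ∀ {β} → β < α → Below
        image β<α = _ , fromWitness (E.bounded β<α)

    cardinal≺κ : cardinal ≺ κ
    cardinal≺κ =
      record { to = proj₁ ; cong = cong proj₁ ; injective = below-≡ } ,
      λ κ≲ → let open Injection κ≲ in
        initial size (proj₁ ∘ to) (injective ∘ below-≡) (below< ∘ to)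

    preimage : K → K
    preimage γ with em {∃ λ β → β < α × E.to β ≡ γ}
    ... | yes (β , _) = β
    ... | no  _       = γ

    preimage-to : ∀ {β} → β < α → preimage (E.to β) ≡ β
    preimage-to {β} β<α with em {∃ λ β′ → β′ < α × E.to β′ ≡ E.to β}
    ... | yes (β′ , β′<α , eq) = E.injective β′<α β<α eq
    ... | no ∄β′               = contradiction (β , β<α , refl) ∄β′

-- Coding functions on initial segments by elements of κ.

module Coding {ℓ} (em : ExcludedMiddle ℓ) (κ : Cardinal ℓ)
              (infinite : Infinite κ) (weakPower : IsOwnWeakPower κ) where

  open WellOrder em κ public

  ι : ℕ → K
  ι = Injection.to infinite

  ι-injective : ∀ {m n} → ι m ≡ ι n → m ≡ n
  ι-injective = Injection.injective infinite

  -- Composing with `preimage`, a left inverse of the embedding, moves g to the cardinal μ of the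
  -- segment below α; the code then comes from κ^μ ≤ κ.
  encode : K → (K → K) → K
  encode α g = Injection.to (proj₁ weakPower (S.cardinal , S.cardinal≺κ)) (g ∘ S.preimage ∘ proj₁)
    where module S = Segment α

  encode-injective : ∀ {α} (g h : K → K) → encode α g ≡ encode α h →
                     ∀ {β} → β < α → g β ≡ h β
  encode-injective {α} g h eq {β} β<α = begin
    g β                        ≡⟨ cong g (S.preimage-to β<α) ⟨
    g (S.preimage (S.E.to β))  ≡⟨ Injection.injective (proj₁ weakPower (S.cardinal , S.cardinal≺κ)) eq
                                    (S.E.to β , fromWitness (S.E.bounded β<α)) ⟩
    h (S.preimage (S.E.to β))  ≡⟨ cong h (S.preimage-to β<α) ⟩
    h β                        ∎
    where
    module S = Segment α
    open ≡-Reasoning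

  -- Two distinct elements below γ let a pair be coded as a function on the segment below γ. The
  -- largest of `ι 0`, `ι 1`, `ι 2` serves as γ.
  twoBelow : ∃ λ γ → ∃₂ λ α β → α < γ × β < γ × α ≢ β
  twoBelow with compare (ι 0) (ι 1)
  twoBelow | tri≈ _ eq _ = contradiction (ι-injective eq) λ ()
  twoBelow | tri< 0<1 0≢1 _ with compare (ι 1) (ι 2)
  ... | tri< 1<2 _ _ = ι 2 , ι 0 , ι 1 , <-trans 0<1 1<2 , 1<2 , 0≢1
  ... | tri≈ _ eq _  = contradiction (ι-injective eq) λ ()
  ... | tri> _ _ 2<1 = ι 1 , ι 0 , ι 2 , 0<1 , 2<1 , λ eq → contradiction (ι-injective eq) λ ()
  twoBelow | tri> _ 0≢1 1<0 with compare (ι 0) (ι 2)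
  ... | tri< 0<2 _ _ = ι 2 , ι 0 , ι 1 , 0<2 , <-trans 1<0 0<2 , 0≢1
  ... | tri≈ _ eq _  = contradiction (ι-injective eq) λ ()
  ... | tri> _ _ 2<0 = ι 0 , ι 1 , ι 2 , 1<0 , 2<0 , λ eq → contradiction (ι-injective eq) λ ()

  choose : ∀ {P : Set ℓ} → Dec P → K → K → K
  choose (yes _) x y = x
  choose (no  _) x y = y

  choose-yes : ∀ {P : Set ℓ} (d : Dec P) {x y} → P → choose d x y ≡ x
  choose-yes (yes _) _ = refl
  choose-yes (no ¬p) p = contradiction p ¬p

  choose-no : ∀ {P : Set ℓ} (d : Dec P) {x y} → ¬ P → choose d x y ≡ y
  choose-no (yes p) ¬p = contradiction p ¬p
  choose-no (no  _) _  = refl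

  private
    γ₀ α₀ β₀ : K
    γ₀ = proj₁ twoBelow
    α₀ = proj₁ (proj₂ twoBelow)
    β₀ = proj₁ (proj₂ (proj₂ twoBelow))

    pairing : K → K → K → K
    pairing x y δ = choose (δ ≟ α₀) x y

  pair : K → K → K
  pair x y = encode γ₀ (pairing x y)

  pair-injectiveˡ : ∀ {x y x′ y′} → pair x y ≡ pair x′ y′ → x ≡ x′
  pair-injectiveˡ {x} {y} {x′} {y′} eq =
    let _ , _ , _ , α<γ , _ = twoBelow in begin
    x                ≡⟨ choose-yes (α₀ ≟ α₀) refl ⟨
    pairing x y α₀   ≡⟨ encode-injective (pairing x y) (pairing x′ y′) eq α<γ ⟩
    pairing x′ y′ α₀ ≡⟨ choose-yes (α₀ ≟ α₀) refl ⟩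
    x′               ∎
    where open ≡-Reasoning

  pair-injectiveʳ : ∀ {x y x′ y′} → pair x y ≡ pair x′ y′ → y ≡ y′
  pair-injectiveʳ {x} {y} {x′} {y′} eq =
    let _ , _ , _ , _ , β<γ , α≢β = twoBelow in begin
    y                ≡⟨ choose-no (β₀ ≟ α₀) (α≢β ∘ sym) ⟨
    pairing x y β₀   ≡⟨ encode-injective (pairing x y) (pairing x′ y′) eq β<γ ⟩
    pairing x′ y′ β₀ ≡⟨ choose-no (β₀ ≟ α₀) (α≢β ∘ sym) ⟩
    y′               ∎
    where open ≡-Reasoning

  -- Finite sets of levels as descending lists, and the nodes of the tree.

  Descending : Pred (List K) ℓ
  Descending = AllPairs (flip _<_)

  insert : ∀ δ {D} → Descending D →
           ∃ λ D′ → Descending D′ × δ ∈ D′ × (∀ {β} → β ∈ D → β ∈ D′) × (∀ {β} → β ∈ D′ → β ∈ δ ∷ D)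
  insert δ [] = δ ∷ [] , [] ∷ [] , here refl , (λ ()) , λ p → p
  insert δ {β ∷ E} (E<β ∷ E↓) with compare β δ
  ... | tri< β<δ _ _ =
    δ ∷ β ∷ E , (β<δ ∷ All.map (λ ε<β → <-trans ε<β β<δ) E<β) ∷ E<β ∷ E↓ , here refl , there , λ p → p
  ... | tri≈ _ β≡δ _ = β ∷ E , E<β ∷ E↓ , here (sym β≡δ) , (λ p → p) , there
  ... | tri> _ _ δ<β with insert δ E↓
  ...   | E′ , E′↓ , δ∈E′ , E⊆E′ , E′⊆ =
    β ∷ E′ , tabulate (λ p → below (E′⊆ p)) ∷ E′↓ , there δ∈E′ ,
    (λ { (here p) → here p ; (there p) → there (E⊆E′ p) }) ,
    λ { (here p) → there (here p) ; (there p) → swap (E′⊆ p) }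
    where
    below : ∀ {ε} → ε ∈ δ ∷ E → ε < β
    below (here refl) = δ<β
    below (there p)   = All.lookup E<β p
    swap : ∀ {ε} → ε ∈ δ ∷ E → ε ∈ δ ∷ β ∷ E
    swap (here p)  = here p
    swap (there p) = there (there p)

  -- code δ F determines the values of F on the descending lists below δ.  Reading such
  -- a list from its head turns F into its value at [] together with a function from the
  -- elements β < δ to codes of functions on the descending lists below β.
  mutual
    code : ∀ δ → Acc _<_ δ → (List K → ℕ) → K
    code δ (acc rs) F = pair (ι (F [])) (encode δ λ β → codeBelow rs F β (β <? δ))

    codeBelow : ∀ {δ} → (∀ {β} → β < δ → Acc _<_ β) → (List K → ℕ) → ∀ β → Dec (β < δ) → K
    codeBelow rs F β (yes β<δ) = code β (rs β<δ) (F ∘ (β ∷_))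
    -- Any default will do: codes are compared only at arguments below δ.
    codeBelow rs F β (no  _)   = ι 0

  code-injective : ∀ {δ} (a a′ : Acc _<_ δ) F F′ → code δ a F ≡ code δ a′ F′ →
                   ∀ {E} → Descending (δ ∷ E) → F E ≡ F′ E
  code-injective (acc rs) (acc rs′) F F′ eq {[]} _ = ι-injective (pair-injectiveˡ eq)
  code-injective {δ} (acc rs) (acc rs′) F F′ eq {β ∷ E} ((β<δ ∷ _) ∷ E↓) =
    step (β <? δ) (encode-injective (λ β → codeBelow rs F β (β <? δ))
      (λ β → codeBelow rs′ F′ β (β <? δ)) (pair-injectiveʳ eq) β<δ)
    where
    step : ∀ d → codeBelow rs F β d ≡ codeBelow rs′ F′ β d → F (β ∷ E) ≡ F′ (β ∷ E)
    step (yes β<δ) eq = code-injective (rs β<δ) (rs′ β<δ) (F ∘ (β ∷_)) (F′ ∘ (β ∷_)) eq E↓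
    step (no β≮δ)  _  = contradiction β<δ β≮δ

  Node : Set ℓ
  Node = K × K

  node : (List K → ℕ) → K → Node
  node F δ = δ , code δ (wellFounded δ) (F ∘ (δ ∷_))

  node-injective : ∀ {F F′ δ δ′ E} → node F δ ≡ node F′ δ′ → Descending (δ ∷ E) →
                   F (δ ∷ E) ≡ F′ (δ′ ∷ E)
  node-injective {F} {F′} {δ} eq E↓ with refl ← cong proj₁ eq =
    code-injective (wellFounded δ) (wellFounded δ) (F ∘ (δ ∷_)) (F′ ∘ (δ ∷_)) (cong proj₂ eq) E↓

  -- Uniform bounds over all functions through finitely many nodes.

  listBound : ∀ {a} {A : Set a} (R : A → ℕ → Set ℓ) →
              (∀ {x m n} → m ≤ n → R x m → R x n) → (∀ x → ∃ (R x)) →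
              ∀ xs → ∃ λ n → ∀ {x} → x ∈ xs → R x n
  listBound R mono ex []       = 0 , λ ()
  listBound R mono ex (x ∷ xs) =
    let m , Rx = ex x ; n , Rxs = listBound R mono ex xs in
    m ⊔ n , λ { (here refl) → mono (m≤m⊔n m n) Rx ; (there p) → mono (m≤n⊔m m n) (Rxs p) }

  -- Only finitely many E qualify, but they need not be listed: the head of E is one of the finitely
  -- many β in L below δ, and recursion along the well-order bounds R for the tails.
  descendingBound : ∀ (L : List K) {δ} → Acc _<_ δ → (R : List K → ℕ → Set ℓ) →
                    (∀ {E m n} → m ≤ n → R E m → R E n) → (∀ E → ∃ (R E)) →
                    ∃ λ n → ∀ {E} → Descending (δ ∷ E) → All (_∈ L) E → R E n
  descendingBound L {δ} (acc rs) R mono ex =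
    let m , R[] = ex []
        n , R∷  = listBound R′ (λ m≤n r β<δ E↓ E⊆L → mono m≤n (r β<δ E↓ E⊆L)) ex′ L
    in m ⊔ n , λ
      { {[]}    _                  _           → mono (m≤m⊔n m n) R[]
      ; {β ∷ E} ((β<δ ∷ _) ∷ E↓) (β∈L ∷ E⊆L) → mono (m≤n⊔m m n) (R∷ β∈L β<δ E↓ E⊆L)
      }
    where
    R′ : K → ℕ → Set ℓ
    R′ β n = β < δ → ∀ {E} → Descending (β ∷ E) → All (_∈ L) E → R (β ∷ E) n
    ex′ : ∀ β → ∃ (R′ β)
    ex′ β with β <? δ
    ... | no β≮δ  = 0 , λ β<δ → contradiction β<δ β≮δ
    ... | yes β<δ = let n , r = descendingBound L (rs β<δ) (R ∘ (β ∷_)) mono (ex ∘ (β ∷_)) in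
                    n , λ _ → r

  -- The empty set of levels is left out because no node records `F []`.
  Bounds : List Node → ℕ → Set ℓ
  Bounds S n = ∀ F {δ E} → Descending (δ ∷ E) → (∀ {β} → β ∈ δ ∷ E → node F β ∈ S) → F (δ ∷ E) ≤ n

  -- There may be infinitely many F, but those through a given node s of S agree on each set whose
  -- maximum is the level of s. Only finitely many such sets use levels of S, so finitely many
  -- values must be bounded.
  bounds-exist : ∀ S → ∃ (Bounds S)
  bounds-exist S =
    let n , bound = listBound R (λ m≤n r F eq E↓ E⊆L → ≤-trans (r F eq E↓ E⊆L) m≤n) R-exists S in
    n , λ F E↓ nodes → bound (nodes (here refl)) F refl E↓
      (tabulate λ β∈E → ∈-map⁺ proj₁ (nodes (there β∈E)))
    where
    L : List K
    L = map proj₁ S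
    R : Node → ℕ → Set ℓ
    R s n = ∀ F {δ E} → node F δ ≡ s → Descending (δ ∷ E) → All (_∈ L) E → F (δ ∷ E) ≤ n
    R-exists : ∀ s → ∃ (R s)
    R-exists s =
      let n , q = descendingBound L (wellFounded (proj₁ s)) Q
                    (λ m≤n q F eq E↓ → ≤-trans (q F eq E↓) m≤n) Q-exists in
      n , λ { F refl E↓ E⊆L → q E↓ E⊆L F refl E↓ }
      where
      Q : List K → ℕ → Set ℓ
      Q E n = ∀ F {δ} → node F δ ≡ s → Descending (δ ∷ E) → F (δ ∷ E) ≤ n
      Q-exists : ∀ E → ∃ (Q E)
      -- Any single F through s supplies the bound for all of them, by `node-injective`; if there is
      -- none, 0 holds vacuously.
      Q-exists E with em {∃₂ λ F δ → node F δ ≡ s × Descending (δ ∷ E)}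
      ... | yes (F , δ , eq , _) = F (δ ∷ E) , λ F′ eq′ E↓ →
        ≤-reflexive (node-injective {F′} {F} (trans eq′ (sym eq)) E↓)
      ... | no ∄F                = 0 , λ F eq E↓ → contradiction (F , _ , eq , E↓) ∄F

-- Monotonicity of generation and of the lower central series.

module _ {c ℓ} (G : Group c ℓ) where

  generated-mono : ∀ {p q} {P : Pred (Group.Carrier G) p} {Q : Pred (Group.Carrier G) q} →
                   P ⊆ Q → Generated G P ⊆ Generated G Q
  generated-mono P⊆Q (gen Px)      = gen (P⊆Q Px)
  generated-mono P⊆Q unit          = unit
  generated-mono P⊆Q (mul x∈ y∈)   = mul (generated-mono P⊆Q x∈) (generated-mono P⊆Q y∈)
  generated-mono P⊆Q (inv x∈)      = inv (generated-mono P⊆Q x∈)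
  generated-mono P⊆Q (resp x≈y x∈) = resp x≈y (generated-mono P⊆Q x∈)

  lowerCentral-suc : ∀ n → lowerCentral G (suc n) ⊆ lowerCentral G n
  lowerCentral-suc zero    _ = tt
  lowerCentral-suc (suc n) = generated-mono λ (x , y , x∈ , z≈) → x , y , lowerCentral-suc n x∈ , z≈

  lowerCentral-antitone : ∀ {m n} → m ≤ n → lowerCentral G n ⊆ lowerCentral G m
  lowerCentral-antitone m≤n = go (≤⇒≤′ m≤n)
    where
    go : ∀ {m n} → m ≤′ n → lowerCentral G n ⊆ lowerCentral G m
    go (≤′-reflexive refl)        x∈ = x∈
    go {n = suc n} (≤′-step m≤′n) x∈ = go m≤′n (lowerCentral-suc n x∈)

-- The group presented by the nodes.

module Construction {ℓ} (em : ExcludedMiddle ℓ) (κ : Cardinal ℓ)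
                    (infinite : Infinite κ) (weakPower : IsOwnWeakPower κ) where

  open Coding em κ infinite weakPower

  infixl 7 _·_
  infix  8 _⁻

  data Term : Set ℓ where
    var : Node → Term
    one : Term
    _·_ : Term → Term → Term
    _⁻  : Term → Term

  tag : Term → ℕ
  tag (var _) = 0
  tag one     = 1
  tag (_ · _) = 2
  tag (_ ⁻)   = 3

  mutual
    -- A Gödel numbering with values in κ, from which the bound on the cardinality of `G` is
    -- obtained.
    ⌜_⌝ : Term → K
    ⌜ t ⌝ = pair (ι (tag t)) (body t)

    body : Term → K
    body (var (δ , α)) = pair δ α
    body one           = ι 0
    body (t · u)       = pair ⌜ t ⌝ ⌜ u ⌝
    body (t ⁻)         = ⌜ t ⌝

  mutual
    ⌜⌝-injective : ∀ t u → ⌜ t ⌝ ≡ ⌜ u ⌝ → t ≡ u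
    ⌜⌝-injective t u eq =
      body-injective t u (ι-injective (pair-injectiveˡ eq)) (pair-injectiveʳ eq)

    body-injective : ∀ t u → tag t ≡ tag u → body t ≡ body u → t ≡ u
    body-injective (var _) (var _)   _ eq =
      cong var (cong₂ _,_ (pair-injectiveˡ eq) (pair-injectiveʳ eq))
    body-injective one     one       _ _  = refl
    body-injective (t · u) (t′ · u′) _ eq =
      cong₂ _·_ (⌜⌝-injective t t′ (pair-injectiveˡ eq)) (⌜⌝-injective u u′ (pair-injectiveʳ eq))
    body-injective (t ⁻)   (u ⁻)     _ eq = cong _⁻ (⌜⌝-injective t u eq)

  -- Unlike `Generated`, this has no closure under equality of the group, so `Γ` can be defined
  -- before `_≈_`, whose relations mention it.
  data Closure (P : Pred Term ℓ) : Pred Term ℓ where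
    gen  : ∀ {t} → P t → Closure P t
    unit : Closure P one
    mul  : ∀ {t u} → Closure P t → Closure P u → Closure P (t · u)
    inv  : ∀ {t} → Closure P t → Closure P (t ⁻)

  -- Γ S n consists of terms for the n-th term of the lower central series of the subgroup
  -- generated by S, with the indexing of lowerCentral.
  Γ : List Node → ℕ → Pred Term ℓ
  Γ S zero    = Closure λ t → ∃ λ s → s ∈ S × t ≡ var s
  Γ S (suc n) = Closure λ t → ∃₂ λ x y → Γ S n x × Γ S zero y × t ≡ x ⁻ · y ⁻ · x · y

  infix 4 _≈_

  data _≈_ : Term → Term → Set ℓ where
    ≈-refl    : ∀ {t} → t ≈ t
    ≈-sym     : ∀ {t u} → t ≈ u → u ≈ t
    ≈-trans   : ∀ {t u v} → t ≈ u → u ≈ v → t ≈ v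
    ·-cong    : ∀ {t t′ u u′} → t ≈ t′ → u ≈ u′ → t · u ≈ t′ · u′
    ⁻-cong    : ∀ {t u} → t ≈ u → t ⁻ ≈ u ⁻
    ·-assoc   : ∀ t u v → (t · u) · v ≈ t · (u · v)
    identityˡ : ∀ t → one · t ≈ t
    identityʳ : ∀ t → t · one ≈ t
    inverseˡ  : ∀ t → t ⁻ · t ≈ one
    inverseʳ  : ∀ t → t · t ⁻ ≈ one
    -- `Γ S n` stands for γₙ₊₁, so killing it gives class at most n.
    nilpotent : ∀ {S n t} → Bounds S n → Γ S n t → t ≈ one

  G : Group ℓ ℓ
  G = record
    { Carrier = Term
    ; _≈_     = _≈_
    ; _∙_     = _·_
    ; ε       = one
    ; _⁻¹     = _⁻
    ; isGroup = record
      { isMonoid = record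
        { isSemigroup = record
          { isMagma = record
            { isEquivalence = record { refl = ≈-refl ; sym = ≈-sym ; trans = ≈-trans }
            ; ∙-cong        = ·-cong
            }
          ; assoc = ·-assoc
          }
        ; identity = identityˡ , identityʳ
        }
      ; inverse = inverseˡ , inverseʳ
      ; ⁻¹-cong = ⁻-cong
      }
    }

  -- A term is sent to the least code of the terms equal to it in `G`, which depends only on its
  -- class and determines that class.
  G≲κ : Group.setoid G ≲ κ
  G≲κ = record
    { to        = λ t → proj₁ (canonical t)
    ; cong      = λ {t} {u} t≈u → least-unique
        (λ (v , v≈t , eq) → v , ≈-trans v≈t t≈u , eq)
        (λ (v , v≈u , eq) → v , ≈-trans v≈u (≈-sym t≈u) , eq)
        (proj₂ (canonical t)) (proj₂ (canonical u))
    ; injective = λ {t} {u} → same-code {t} {u} (canonical t) (canonical u)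
    }
    where
    CodeOf : Term → Pred K ℓ
    CodeOf t α = ∃ λ u → u ≈ t × ⌜ u ⌝ ≡ α
    canonical : ∀ t → ∃ (IsLeast (CodeOf t))
    canonical t = least (⌜ t ⌝ , t , ≈-refl , refl)
    same-code : ∀ {t u} (x : ∃ (IsLeast (CodeOf t))) (y : ∃ (IsLeast (CodeOf u))) →
                proj₁ x ≡ proj₁ y → t ≈ u
    same-code (α , (v , v≈t , v↦α) , _) (.α , (w , w≈u , w↦α) , _) refl
      with refl ← ⌜⌝-injective v w (trans v↦α (sym w↦α)) = ≈-trans (≈-sym v≈t) w≈u

  vars : Term → List Node
  vars (var s) = s ∷ []
  vars one     = []
  vars (t · u) = vars t ++ vars u
  vars (t ⁻)   = vars t

  Γ-vars : ∀ {S} t → (∀ {s} → s ∈ vars t → s ∈ S) → Γ S zero t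
  Γ-vars (var s) ⊆S = gen (s , ⊆S (here refl) , refl)
  Γ-vars one     ⊆S = unit
  Γ-vars (t · u) ⊆S = mul (Γ-vars t (⊆S ∘ ∈-++⁺ˡ)) (Γ-vars u (⊆S ∘ ∈-++⁺ʳ (vars t)))
  Γ-vars (t ⁻)   ⊆S = inv (Γ-vars t ⊆S)

  module _ (xs : List Term) where

    open Membership (Group.setoid G) using () renaming (_∈_ to _∈ᴳ_)

    private
      S : List Node
      S = concatMap vars xs

    ∈⇒Γ : ∀ {x} → x ∈ᴳ xs → ∃ λ t → Γ S zero t × t ≈ x
    ∈⇒Γ x∈xs = let t , ⊆S , t≈x = go x∈xs in t , Γ-vars t ⊆S , t≈x
      where
      go : ∀ {xs x} → x ∈ᴳ xs → ∃ λ t → (∀ {s} → s ∈ vars t → s ∈ concatMap vars xs) × t ≈ x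
      go (here {x = t} x≈t) = t , ∈-++⁺ˡ , ≈-sym x≈t
      go (there {x = u} x∈) = let t , ⊆S , t≈x = go x∈ in t , ∈-++⁺ʳ (vars u) ∘ ⊆S , t≈x

    generated⇒Γ : ∀ {x} → Generated G (_∈ᴳ xs) x → ∃ λ t → Γ S zero t × t ≈ x
    generated⇒Γ (gen x∈)      = ∈⇒Γ x∈
    generated⇒Γ unit          = one , unit , ≈-refl
    generated⇒Γ (mul x∈ y∈)   =
      let t , t∈ , t≈x = generated⇒Γ x∈ ; u , u∈ , u≈y = generated⇒Γ y∈ in
      t · u , mul t∈ u∈ , ·-cong t≈x u≈y
    generated⇒Γ (inv x∈)      = let t , t∈ , t≈x = generated⇒Γ x∈ in t ⁻ , inv t∈ , ⁻-cong t≈x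
    generated⇒Γ (resp x≈y x∈) = let t , t∈ , t≈x = generated⇒Γ x∈ in t , t∈ , ≈-trans t≈x x≈y

    -- The relation `nilpotent` speaks of literal terms over a list of nodes. Every member of xs is
    -- a word in the nodes of S, so elements of the series can be replaced by equal terms to which
    -- the relation applies.
    lowerCentral⇒Γ : ∀ n {x} → lowerCentral (⟨_⟩ G xs) n x → ∃ λ t → Γ S n t × t ≈ proj₁ x
    lowerCentral⇒Γ zero {_ , x∈} _ = generated⇒Γ x∈
    lowerCentral⇒Γ (suc n)         = go
      where
      go : ∀ {x} → lowerCentral (⟨_⟩ G xs) (suc n) x → ∃ λ t → Γ S (suc n) t × t ≈ proj₁ x
      go (gen (x , y , x∈ , z≈)) =
        let t , t∈ , t≈x = lowerCentral⇒Γ n x∈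
            u , u∈ , u≈y = generated⇒Γ (proj₂ y) in
        t ⁻ · u ⁻ · t · u , gen (t , u , t∈ , u∈ , refl) ,
        ≈-trans (·-cong (·-cong (·-cong (⁻-cong t≈x) (⁻-cong u≈y)) t≈x) u≈y) (≈-sym z≈)
      go unit          = one , unit , ≈-refl
      go (mul x∈ y∈)   =
        let t , t∈ , t≈x = go x∈ ; u , u∈ , u≈y = go y∈ in
        t · u , mul t∈ u∈ , ·-cong t≈x u≈y
      go (inv x∈)      = let t , t∈ , t≈x = go x∈ in t ⁻ , inv t∈ , ⁻-cong t≈x
      go (resp x≈y x∈) = let t , t∈ , t≈x = go x∈ in t , t∈ , ≈-trans t≈x x≈y

    ⟨xs⟩-nilpotent : Nilpotent (⟨_⟩ G xs)
    ⟨xs⟩-nilpotent = let n , bounds = bounds-exist S in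
      n , λ x x∈ → let t , t∈ , t≈x = lowerCentral⇒Γ n x∈ in
      ≈-trans (≈-sym t≈x) (nilpotent bounds t∈)

  -- The epimorphism onto a given member of the class.

  module Epimorphism (H : Group ℓ ℓ) (H∈LN : LN κ H) where

    private
      module H = Group H
      module HP = GroupProperties H
    open LN H∈LN
    open Injection cardinality using () renaming (to to index; injective to index-injective)
    open Membership H.setoid using () renaming (_∈_ to _∈ᴴ_)

    enumerate : K → H.Carrier
    enumerate δ with em {∃ λ x → index x ≡ δ}
    ... | yes (x , _) = x
    ... | no  _       = H.ε

    enumerate-index : ∀ x → enumerate (index x) H.≈ x
    enumerate-index x with em {∃ λ y → index y ≡ index x}
    ... | yes (y , eq) = index-injective eq
    ... | no ∄y        = contradiction (x , refl) ∄y

    -- The bound that local nilpotency supplies, not necessarily the exact nilpotency class.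
    class : List K → ℕ
    class D = proj₁ (locallyNilpotent (map enumerate D))

    assign : Node → H.Carrier
    assign s with em {∃ λ δ → node class δ ≡ s}
    ... | yes (δ , _) = enumerate δ
    ... | no  _       = H.ε

    assign-node : ∀ δ → assign (node class δ) ≡ enumerate δ
    assign-node δ with em {∃ λ δ′ → node class δ′ ≡ node class δ}
    -- A node carries its level, so δ′ and δ coincide.
    ... | yes (δ′ , eq) = cong (enumerate ∘ proj₁) eq
    ... | no ∄δ′        = contradiction (δ , refl) ∄δ′

    eval : Term → H.Carrier
    eval (var s) = assign s
    eval one     = H.ε
    eval (t · u) = eval t H.∙ eval u
    eval (t ⁻)   = eval t H.⁻¹

    -- D collects the levels of the nodes of S on the branch of `class`. All other nodes go to 1, so
    -- the images of S lie in the subgroup generated by the elements enumerated at D.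
    branch : ∀ S → ∃ λ D → Descending D × (∀ {δ} → δ ∈ D → node class δ ∈ S) ×
             (∀ {s} → s ∈ S → Generated H (_∈ᴴ map enumerate D) (assign s))
    branch []      = [] , [] , (λ ()) , λ ()
    branch (s ∷ S) with branch S | em {∃ λ δ → node class δ ≡ s}
    ... | D , D↓ , D⊆ , assign∈ | no ∄δ = D , D↓ , there ∘ D⊆ , λ
      { (here refl) → subst (Generated H _) (sym (assign-off ∄δ)) unit ; (there p) → assign∈ p }
      where
      assign-off : ¬ (∃ λ δ → node class δ ≡ s) → assign s ≡ H.ε
      assign-off ∄δ with em {∃ λ δ → node class δ ≡ s}
      ... | yes ∃δ = contradiction ∃δ ∄δ
      ... | no _   = refl
    ... | D , D↓ , D⊆ , assign∈ | yes (δ , refl) with insert δ D↓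
    ...   | D′ , D′↓ , δ∈D′ , D⊆D′ , D′⊆ = D′ , D′↓ , nodes ∘ D′⊆ , λ
      { (here refl) → subst (Generated H _) (sym (assign-node δ)) (gen (∈-enumerate δ∈D′))
      ; (there p)   → generated-mono H grow (assign∈ p) }
      where
      ∈-enumerate : ∀ {β} → β ∈ D′ → enumerate β ∈ᴴ map enumerate D′
      ∈-enumerate β∈D′ = Any.map H.reflexive (∈-map⁺ enumerate β∈D′)
      nodes : ∀ {β} → β ∈ δ ∷ D → node class β ∈ node class δ ∷ S
      nodes (here refl) = here refl
      nodes (there p)   = there (D⊆ p)
      grow : ∀ {x} → x ∈ᴴ map enumerate D → x ∈ᴴ map enumerate D′
      grow = map-mono D⊆D′
        where
        map-mono : ∀ {D x} → (∀ {β} → β ∈ D → β ∈ D′) → x ∈ᴴ map enumerate D → x ∈ᴴ map enumerate D′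
        map-mono {β ∷ D} ⊆D′ (here x≈) = Any.map (λ { refl → x≈ }) (∈-map⁺ enumerate (⊆D′ (here refl)))
        map-mono {β ∷ D} ⊆D′ (there p) = map-mono (⊆D′ ∘ there) p

    module _ {S : List Node} {p} {P : Pred H.Carrier p}
             (assign∈ : ∀ {s} → s ∈ S → Generated H P (assign s)) where

      eval-Γ₀ : ∀ {t} → Γ S zero t → Generated H P (eval t)
      eval-Γ₀ (gen (s , s∈S , refl)) = assign∈ s∈S
      eval-Γ₀ unit                   = unit
      eval-Γ₀ (mul t∈ u∈)            = mul (eval-Γ₀ t∈) (eval-Γ₀ u∈)
      eval-Γ₀ (inv t∈)               = inv (eval-Γ₀ t∈)

      -- Elements of `generatedGroup H P` carry their membership proofs, so these are built together
      -- with membership in the series.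
      eval-Γ : ∀ n {t} → Γ S n t → ∃ λ t∈ → lowerCentral (generatedGroup H P) n (eval t , t∈)
      eval-Γ zero    t∈ = eval-Γ₀ t∈ , tt
      eval-Γ (suc n) = go
        where
        go : ∀ {t} → Γ S (suc n) t → ∃ λ t∈ → lowerCentral (generatedGroup H P) (suc n) (eval t , t∈)
        go (gen (x , y , x∈Γ , y∈Γ , refl)) =
          let x∈ , x∈γ = eval-Γ n x∈Γ ; y∈ = eval-Γ₀ y∈Γ in
          mul (mul (mul (inv x∈) (inv y∈)) x∈) y∈ ,
          gen ((eval x , x∈) , (eval y , y∈) , x∈γ , H.refl)
        go unit        = unit , unit
        go (mul t∈ u∈) = let p , t∈γ = go t∈ ; q , u∈γ = go u∈ in mul p q , mul t∈γ u∈γ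
        go (inv t∈)    = let p , t∈γ = go t∈ in inv p , inv t∈γ

    generated-[] : ∀ {x} → Generated H (_∈ᴴ []) x → x H.≈ H.ε
    generated-[] unit          = H.refl
    generated-[] (mul x∈ y∈)   = H.trans (H.∙-cong (generated-[] x∈) (generated-[] y∈)) (H.identityˡ _)
    generated-[] (inv x∈)      = H.trans (H.⁻¹-cong (generated-[] x∈)) HP.ε⁻¹≈ε
    generated-[] (resp x≈y x∈) = H.trans (H.sym x≈y) (generated-[] x∈)

    eval-nilpotent : ∀ {S n t} → Bounds S n → Γ S n t → eval t H.≈ H.ε
    eval-nilpotent {S} {n} bounds t∈Γ with branch S
    -- `Bounds` says nothing about `class []`, but the subgroup generated by no elements is trivial.
    ... | [] , _ , _ , assign∈ = generated-[] (proj₁ (eval-Γ assign∈ n t∈Γ))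
    -- Here `class D` is at most n, so the n-th term of the series lies in the term at `class D`,
    -- which is trivial.
    ... | D@(δ ∷ E) , D↓ , D⊆ , assign∈ =
      proj₂ (locallyNilpotent (map enumerate D)) _
        (lowerCentral-antitone _ (bounds class D↓ D⊆) (proj₂ (eval-Γ assign∈ n t∈Γ)))

    eval-cong : ∀ {t u} → t ≈ u → eval t H.≈ eval u
    eval-cong ≈-refl               = H.refl
    eval-cong (≈-sym eq)           = H.sym (eval-cong eq)
    eval-cong (≈-trans eq eq′)     = H.trans (eval-cong eq) (eval-cong eq′)
    eval-cong (·-cong eq eq′)      = H.∙-cong (eval-cong eq) (eval-cong eq′)
    eval-cong (⁻-cong eq)          = H.⁻¹-cong (eval-cong eq)
    eval-cong (·-assoc t u v)      = H.assoc _ _ _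
    eval-cong (identityˡ t)        = H.identityˡ _
    eval-cong (identityʳ t)        = H.identityʳ _
    eval-cong (inverseˡ t)         = H.inverseˡ _
    eval-cong (inverseʳ t)         = H.inverseʳ _
    eval-cong (nilpotent bounds t∈Γ) = eval-nilpotent bounds t∈Γ

    epimorphism : G ↠ᴳ H
    epimorphism = eval , isGroupHomomorphism , λ x →
      var (node class (index x)) , λ t≈ → H.trans (eval-cong t≈)
        (H.trans (H.reflexive (assign-node (index x))) (enumerate-index x))
      where
      open GroupMorphisms (Group.rawGroup G) H.rawGroup using (IsGroupHomomorphism)
      isGroupHomomorphism : IsGroupHomomorphism eval
      isGroupHomomorphism = record
        { isMonoidHomomorphism = record
          { isMagmaHomomorphism = record
            { isRelHomomorphism = record { cong = eval-cong }
            ; homo              = λ _ _ → H.refl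
            }
          ; ε-homo = H.refl
          }
        ; ⁻¹-homo = λ _ → H.refl
        }

  epiUniversal : EpiUniversal κ G
  epiUniversal = record
    { member    = record { locallyNilpotent = ⟨xs⟩-nilpotent ; cardinality = G≲κ }
    ; universal = Epimorphism.epimorphism
    }

theorem2p8 : ∀ {ℓ} → ExcludedMiddle ℓ →
    (κ : Cardinal ℓ) → Infinite κ → IsOwnWeakPower κ →
    ∃ λ (G : Group ℓ ℓ) → EpiUniversal κ G
theorem2p8 em κ infinite weakPower = G , epiUniversal
  where open Construction em κ infinite weakPower
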